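{- For all integers $m,n\ge0$ there is a bijection $$\phi:\mathcal{D}(m,n)\to \mathcal{D}(m,n-2m)\cup\mathcal{D}(m-1,n-2m+1)\cup\mathcal{D}(m-2,n-2m+2).$$ In particular, writing $D(m,n)=|\mathcal{D}(m,n)|$, $$D(m,n)=D(m,n-2m)+D(m-1,n-2m+1)+D(m-2,n-2m+2).$$
   Context: A Schur partition is a partition of an integer into positive parts such that consecutive parts differ by at least $3$, and no two consecutive parts differing by exactly $3$ are both multiples of $3$. For a partition $\pi$, $m(\pi)$ is the number of parts of $\pi$ plus the number of even parts of $\pi$. $\mathcal{D}(m,n)$ is the set of Schur partitions $\pi$ of $n$ with $m(\pi)=m$; sets with a negative index are empty, and $\mathcal{D}(0,0)$ consists of the empty partition. -}

module Defs where

open import Data.Nat using (ℕ; zero; suc; _+_; _≤_; _*_)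
open import Data.Nat.Divisibility using (_∣_)
open import Data.Integer as ℤ using (ℤ; +_)
open import Data.List using (List; []; _∷_)
open import Data.Nat.ListAction using (sum)
open import Data.Product using (Σ; _×_; proj₁)
open import Data.Sum using (_⊎_)
open import Relation.Nullary using (¬_)
open import Relation.Binary.PropositionalEquality using (_≡_)
open import Relation.Binary.Bundles using (Setoid)
import Relation.Binary.PropositionalEquality as P
import Relation.Binary.Construct.On as On
open import Function.Bundles using (Bijection)

-- A partition is the list of its parts, written in decreasing order.
-- Schur condition for two consecutive parts a (larger) followed by b:
-- a - b ≥ 3, and not (a - b = 3 and both a, b multiples of 3).
SchurPair : ℕ → ℕ → Set
SchurPair a b = (b + 3 ≤ a) × ¬ ((a ≡ b + 3) × (3 ∣ a) × (3 ∣ b))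

data Schur : List ℕ → Set where
  nil  : Schur []
  one  : ∀ {a} → 1 ≤ a → Schur (a ∷ [])
  cons : ∀ {a b π} → 1 ≤ a → SchurPair a b → Schur (b ∷ π) → Schur (a ∷ b ∷ π)

evens : List ℕ → ℕ
evens [] = 0
evens (a ∷ π) = evenAdd a (evens π)
  where
  evenAdd : ℕ → ℕ → ℕ
  evenAdd zero k = suc k
  evenAdd (suc zero) k = k
  evenAdd (suc (suc a)) k = evenAdd a k

mval : List ℕ → ℕ
mval π = Data.List.length π + evens π

-- π ∈ 𝒟(m,n); indices are integers, so negative indices give empty sets.
In𝒟 : ℤ → ℤ → List ℕ → Set
In𝒟 m n π = Schur π × (+ sum π ≡ n) × (+ mval π ≡ m)

SubsetSetoid : (List ℕ → Set) → Setoid _ _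
SubsetSetoid P = On.setoid (P.setoid (List ℕ)) (proj₁ {B = P})

𝒟 : ℤ → ℤ → Setoid _ _
𝒟 m n = SubsetSetoid (In𝒟 m n)

InTarget : ℕ → ℕ → List ℕ → Set
InTarget m n π =
  In𝒟 (+ m) (+ n ℤ.- + (2 * m)) π
  ⊎ In𝒟 (+ m ℤ.- + 1) (+ n ℤ.- + (2 * m) ℤ.+ + 1) π
  ⊎ In𝒟 (+ m ℤ.- + 2) (+ n ℤ.- + (2 * m) ℤ.+ + 2) π

Target : ℕ → ℕ → Setoid _ _
Target m n = SubsetSetoid (InTarget m n)

{-# OPTIONS --safe #-}
-- Toggle every part of a Schur partition π, odd a ↦ a + 1 and even a ↦ a − 1,
-- except that an even part followed by an odd part is left alone, together with
-- that odd part, when toggling would break the Schur condition between them.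
-- This is an involution on Schur partitions.
-- Subtracting 3 from all parts of the image of π then flips the parities again and
-- preserves the Schur condition, which is invariant under translation by 3; together
-- the two operations lower the sum by 2 m(π).  Only a last part at most 3 needs care:
-- 1 and 2 become −2 and −1 and are discarded, while 3 becomes 1 instead of 0.
-- With t = 2, 1, 1 respectively (and t = 0 if the last part exceeds 3), the result
-- has statistic m − t and sum n − 2m + t.
module Submission where

open import Defs
open import Data.Nat using (ℕ; zero; suc; _+_; _*_; _≤_; _<_; z≤n; s≤s; _≤?_; _≟_)
open import Data.Nat.Properties
open import Data.Nat.Divisibility using (_∣_; _∣?_; ∣m+n∣m⇒∣n; ∣m∣n⇒∣m+n; ∣-refl)
open import Data.Nat.ListAction using (sum)
open import Data.Nat.Tactic.RingSolver using (solve-∀)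
open import Data.Integer as ℤ using (+_)
import Data.Integer.Properties as ℤ
import Data.Integer.Tactic.RingSolver as ℤSolver
open import Data.List using (List; []; _∷_; length)
open import Data.Product using (∃-syntax; _×_; _,_; proj₁; proj₂)
open import Data.Sum using (_⊎_; inj₁; inj₂)
open import Data.Unit using (⊤; tt)
open import Function.Base using (_∘_)
open import Function.Bundles using (Bijection)
open import Relation.Nullary using (¬_; Dec; yes; no; contradiction)
open import Relation.Nullary.Decidable using (_×-dec_; ¬?; from-no)
open import Relation.Binary.PropositionalEquality
  using (_≡_; refl; sym; trans; cong; cong₂; subst; module ≡-Reasoning)

-- Parity of parts

ε : ℕ → ℕ
ε zero          = 1
ε (suc zero)    = 0
ε (suc (suc a)) = ε a

Odd : ℕ → Set
Odd a = ε a ≡ 0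

ε-suc : ∀ a → ε a + ε (suc a) ≡ 1
ε-suc zero          = refl
ε-suc (suc zero)    = refl
ε-suc (suc (suc a)) = ε-suc a

odd⇒ε-suc : ∀ a → Odd a → ε (suc a) ≡ 1
odd⇒ε-suc a o = trans (cong (_+ ε (suc a)) (sym o)) (ε-suc a)

¬odd-suc : ∀ a → Odd a → ¬ Odd (suc a)
¬odd-suc a o o' with trans (sym (odd⇒ε-suc a o)) o'
... | ()

ε≢ε-suc : ∀ a → ¬ ε a ≡ ε (suc a)
ε≢ε-suc zero          ()
ε≢ε-suc (suc zero)    ()
ε≢ε-suc (suc (suc a)) = ε≢ε-suc a

odd-or-odd-pred : ∀ a → 1 ≤ a → Odd a ⊎ ∃[ c ] (a ≡ suc c × Odd c)
odd-or-odd-pred (suc zero)          _ = inj₁ refl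
odd-or-odd-pred (suc (suc zero))    _ = inj₂ (1 , refl , refl)
odd-or-odd-pred (suc (suc (suc a))) _ with odd-or-odd-pred (suc a) (s≤s z≤n)
... | inj₁ o              = inj₁ o
... | inj₂ (c , refl , o) = inj₂ (suc (suc c) , refl , o)

odd⇒positive : ∀ {a} → Odd a → 1 ≤ a
odd⇒positive {suc a} _ = s≤s z≤n

-- Serves to identify the local function of `evens`, known only through its computation rules, with
-- addition of the parity indicator `ε`.
ε-unique : (f : ℕ → ℕ → ℕ) → (∀ k → f 0 k ≡ suc k) → (∀ k → f 1 k ≡ k) →
           (∀ a k → f (2 + a) k ≡ f a k) → ∀ a k → f a k ≡ ε a + k
ε-unique f f0 f1 f2 zero          k = f0 k
ε-unique f f0 f1 f2 (suc zero)    k = f1 k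
ε-unique f f0 f1 f2 (suc (suc a)) k = trans (f2 a k) (ε-unique f f0 f1 f2 a k)

-- The local function of evens has no name outside of Defs: it is found by
-- unification, once its arguments are abstracted to distinct variables.
mutual
  evenAdd : ℕ → List ℕ → ℕ → ℕ → ℕ
  evenAdd = _

  evens-∷ : ∀ a π → evens (a ∷ π) ≡ ε a + evens π
  evens-∷ zero          π = refl
  evens-∷ (suc zero)    π = refl
  evens-∷ (suc (suc a)) π with suc (suc a) | evens π
  ... | b | k = ε-unique (evenAdd b π) (λ _ → refl) (λ _ → refl) (λ _ _ → refl) a k

-- Divisibility by 3 and the Schur condition on pairs

¬3∣1 : ¬ 3 ∣ 1
¬3∣1 = from-no (3 ∣? 1)

3∣-suc : ∀ {a} → 3 ∣ a → ¬ 3 ∣ suc a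
3∣-suc {a} d e = ¬3∣1 (∣m+n∣m⇒∣n (subst (3 ∣_) (+-comm 1 a) e) d)

3∣-+3 : ∀ {a} → 3 ∣ a → 3 ∣ a + 3
3∣-+3 d = ∣m∣n⇒∣m+n d ∣-refl

3∣-+3⁻¹ : ∀ {a} → 3 ∣ a + 3 → 3 ∣ a
3∣-+3⁻¹ {a} d = ∣m+n∣m⇒∣n (subst (3 ∣_) (+-comm a 3) d) ∣-refl

schurPair? : ∀ a b → Dec (SchurPair a b)
schurPair? a b = (b + 3 ≤? a) ×-dec ¬? ((a ≟ b + 3) ×-dec (3 ∣? a) ×-dec (3 ∣? b))

schurPair-far : ∀ {a b} → b + 3 < a → SchurPair a b
schurPair-far p = <⇒≤ p , λ { (refl , _) → <-irrefl refl p }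

schurPair-¬3∣ˡ : ∀ {a b} → b + 3 ≤ a → ¬ 3 ∣ a → SchurPair a b
schurPair-¬3∣ˡ p ¬d = p , λ { (_ , d , _) → ¬d d }

schurPair-¬3∣ʳ : ∀ {a b} → b + 3 ≤ a → ¬ 3 ∣ b → SchurPair a b
schurPair-¬3∣ʳ p ¬d = p , λ { (_ , _ , d) → ¬d d }

schurPair-3+ : ∀ {a b} → SchurPair a b → SchurPair (3 + a) (3 + b)
schurPair-3+ {a} {b} (p , q) = s≤s (s≤s (s≤s p)) , λ { (e , d , d') →
  q (+-cancelˡ-≡ 3 _ _ e , ∣m+n∣m⇒∣n d ∣-refl , ∣m+n∣m⇒∣n d' ∣-refl) }

schurPair-3+⁻¹ : ∀ {a b} → SchurPair (3 + a) (3 + b) → SchurPair a b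
schurPair-3+⁻¹ {a} {b} (s≤s (s≤s (s≤s p)) , q) = p , λ { (e , d , d') →
  q (cong (_+_ 3) e , ∣m∣n⇒∣m+n ∣-refl d , ∣m∣n⇒∣m+n ∣-refl d') }

-- A difference of exactly 3 would change the parity.
same-parity-gap : ∀ {a b} → ε a ≡ ε b → b + 3 ≤ a → b + 3 < a
same-parity-gap {a} {b} e p = ≤∧≢⇒< p λ { refl →
  ε≢ε-suc b (trans (sym e) (cong ε (+-comm b 3))) }

schurPair-gap : ∀ {a b} → ε a ≡ ε b → SchurPair a b → b + 3 < a
schurPair-gap e (p , _) = same-parity-gap e p

infix 4 _▷_

_▷_ : ℕ → List ℕ → Set
a ▷ []      = ⊤
a ▷ (b ∷ _) = SchurPair a b

schur-∷ : ∀ {a π} → 1 ≤ a → a ▷ π → Schur π → Schur (a ∷ π)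
schur-∷ {π = []}    p _ _ = one p
schur-∷ {π = _ ∷ _} p q s = cons p q s

schur-head : ∀ {a π} → Schur (a ∷ π) → 1 ≤ a
schur-head (one p)      = p
schur-head (cons p _ _) = p

schur-tail : ∀ {a π} → Schur (a ∷ π) → Schur π
schur-tail (one _)      = nil
schur-tail (cons _ _ s) = s

-- The toggling involution

-- A relation rather than a function, so that matching exposes the parity and inversion merely
-- exchanges the constructors.
data Toggle : ℕ → ℕ → Set where
  up   : ∀ {a} → Odd a → Toggle a (suc a)
  down : ∀ {a} → Odd a → Toggle (suc a) a

toggle-total : ∀ a → 1 ≤ a → ∃[ a' ] Toggle a a'
toggle-total a p with odd-or-odd-pred a p
... | inj₁ o              = suc a , up o
... | inj₂ (c , refl , o) = c , down o

toggle-sym : ∀ {a a'} → Toggle a a' → Toggle a' a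
toggle-sym (up o)   = down o
toggle-sym (down o) = up o

toggle-functional : ∀ {a a' a''} → Toggle a a' → Toggle a a'' → a' ≡ a''
toggle-functional (up o)   (up _)   = refl
toggle-functional (down o) (down _) = refl
toggle-functional (up o) (down {a} o') = contradiction o (¬odd-suc a o')
toggle-functional (down {a} o) (up o') = contradiction o' (¬odd-suc a o)

toggle-positive : ∀ {a a'} → Toggle a a' → 1 ≤ a
toggle-positive (up o)   = odd⇒positive o
toggle-positive (down _) = s≤s z≤n

-- The even part `suc c` is indexed by its toggled value, so that `clash` sets `c` against `suc b`.
record Locked (c b : ℕ) : Set where
  constructor locked
  field
    odd-c : Odd c
    odd-b : Odd b
    pair  : SchurPair (suc c) b
    clash : ¬ SchurPair c (suc b)

-- Toggling breaks the condition only for gap 3, where neither part is a multiple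
-- of 3, or for gap 5 with both toggled parts multiples of 3.
locked-¬3∣ : ∀ {c b} → Locked c b → ¬ 3 ∣ suc c × ¬ 3 ∣ b
locked-¬3∣ {c} {b} (locked oc ob (p , q) clash) with suc c ≟ b + 3
... | yes e = (λ d → q (e , d , 3∣-+3⁻¹ (subst (3 ∣_) e d)))
            , (λ d → q (e , subst (3 ∣_) (sym e) (3∣-+3 d) , d))
... | no ¬e with c ≟ suc b + 3
...   | no ¬e' = contradiction
                   (schurPair-far (≤∧≢⇒< gap (¬e' ∘ sym))) clash
  where
  gap : suc b + 3 ≤ c
  gap = same-parity-gap (trans oc (sym ob)) (≤-pred (≤∧≢⇒< p (¬e ∘ sym)))
...   | yes refl with 3 ∣? suc b
...     | no ¬d = contradiction (schurPair-¬3∣ʳ ≤-refl ¬d) clash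
...     | yes d = 3∣-suc (3∣-+3 d) , λ d' → 3∣-suc d' d

-- Toggling parts of equal parity keeps their gap, which is even and hence at least 4; odd above
-- even widens the gap by 2. Only even above odd narrows it.
toggle-clash⇒locked : ∀ {a a' b b'} → Toggle a a' → Toggle b b' → SchurPair a b →
  ¬ SchurPair a' b' → a ≡ suc a' × Locked a' b
toggle-clash⇒locked (up o) (up o') p ¬p =
  contradiction (schurPair-far (s≤s (schurPair-gap (trans o (sym o')) p))) ¬p
toggle-clash⇒locked (up o) (down o') (p , _) ¬p =
  contradiction (schurPair-far (s≤s (<⇒≤ p))) ¬p
toggle-clash⇒locked {suc a} {b = suc b} (down o) (down o') p ¬p =
  contradiction (schurPair-far (≤-pred (schurPair-gap
    (trans (odd⇒ε-suc a o) (sym (odd⇒ε-suc b o'))) p))) ¬p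
toggle-clash⇒locked (down o) (up o') p ¬p = refl , locked o o' p ¬p

-- Recording adjacency on both sides makes the relation symmetric by construction, so that totality
-- and functionality also serve its inverse.
data Swap : List ℕ → List ℕ → Set where
  []   : Swap [] []
  step : ∀ {a a' π ρ} → Toggle a a' → a ▷ π → a' ▷ ρ → Swap π ρ →
         Swap (a ∷ π) (a' ∷ ρ)
  lock : ∀ {c b π ρ} → Locked c b → b ▷ π → b ▷ ρ → Swap π ρ →
         Swap (suc c ∷ b ∷ π) (suc c ∷ b ∷ ρ)

swap-sym : ∀ {π ρ} → Swap π ρ → Swap ρ π
swap-sym []             = []
swap-sym (step t p q s) = step (toggle-sym t) q p (swap-sym s)
swap-sym (lock l p q s) = lock l q p (swap-sym s)

swap-schurˡ : ∀ {π ρ} → Swap π ρ → Schur π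
swap-schurˡ []             = nil
swap-schurˡ (step t p _ s) = schur-∷ (toggle-positive t) p (swap-schurˡ s)
swap-schurˡ (lock (locked _ o pair _) p _ s) =
  cons (s≤s z≤n) pair (schur-∷ (odd⇒positive o) p (swap-schurˡ s))

-- The part `b` either toggles too or opens a locked pair and stays; the last two clauses treat the
-- second case.
swap-step-▷ : ∀ {a a' b b' π ρ} → Toggle a a' → Toggle b b' → SchurPair a b →
  SchurPair a' b' → Swap (b ∷ π) ρ → a' ▷ ρ
swap-step-▷ {a' = a'} _ tb _ p' (step tb' _ _ _) =
  subst (SchurPair a') (toggle-functional tb tb') p'
swap-step-▷ (up _) _ (p , _) _ (lock _ _ _ _) = schurPair-far (s≤s p)
-- Both parts are even, so their gap is at least 4 and shrinks to at least 3; gap 3 is allowed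
-- because a locked part is not a multiple of 3.
swap-step-▷ (down {a'} o) _ p _ (lock {c} l _ _ _) =
  schurPair-¬3∣ʳ
    (≤-pred (schurPair-gap
      (trans (odd⇒ε-suc a' o) (sym (odd⇒ε-suc c (Locked.odd-c l)))) p))
    (proj₁ (locked-¬3∣ l))

-- The gap below `b` narrows only when an odd part moves up; it was then at least 4, and `b` is not
-- a multiple of 3.
swap-lock-▷ : ∀ {c b π ρ} → Locked c b → b ▷ π → Swap π ρ → b ▷ ρ
swap-lock-▷ l p []                          = tt
swap-lock-▷ l p (lock _ _ _ _)              = p
swap-lock-▷ l p (step (up o) _ _ _)         =
  schurPair-¬3∣ˡ (schurPair-gap (trans (Locked.odd-b l) (sym o)) p) (proj₂ (locked-¬3∣ l))
swap-lock-▷ l (p , _) (step (down _) _ _ _) = schurPair-far p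

-- A greedy choice from the top: toggle the first part if the toggled first two parts fit, otherwise
-- lock both and resume below them.
swap-total : ∀ {π} → Schur π → ∃[ ρ ] Swap π ρ
swap-total nil     = [] , []
swap-total (one p) = let _ , t = toggle-total _ p in _ , step t tt tt []
swap-total (cons {a} {b} {π} p q s) with toggle-total a p | toggle-total b (schur-head s)
... | a' , ta | b' , tb with schurPair? a' b'
...   | yes r =
  let _ , sw = swap-total s in _ , step ta q (swap-step-▷ ta tb q r sw) sw
...   | no ¬r with toggle-clash⇒locked ta tb q ¬r | s
...     | refl , l | one _       = _ , lock l tt tt []
...     | refl , l | cons _ u s' =
  let _ , sw = swap-total s' in _ , lock l u (swap-lock-▷ l u sw) sw

-- If `suc c` moves down, `b` cannot move up because of `clash`, and being odd it can neither move
-- down nor head a locked pair. Hence the choice between `step` and `lock` is forced.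
¬step-locked : ∀ {c b a' π ρ} → Locked c b → Toggle (suc c) a' → Swap (b ∷ π) ρ → ¬ a' ▷ ρ
¬step-locked {c} l (up o) _ _ = ¬odd-suc c (Locked.odd-c l) o
¬step-locked l (down _) (step (up _) _ _ _) r = Locked.clash l r
¬step-locked l (down _) (step (down {a} o) _ _ _) _ = ¬odd-suc a o (Locked.odd-b l)
¬step-locked l (down _) (lock {c} l' _ _ _) _ = ¬odd-suc c (Locked.odd-c l') (Locked.odd-b l)

swap-functional : ∀ {π ρ ρ'} → Swap π ρ → Swap π ρ' → ρ ≡ ρ'
swap-functional [] [] = refl
swap-functional (step t _ _ s) (step t' _ _ s') =
  cong₂ _∷_ (toggle-functional t t') (swap-functional s s')
swap-functional (lock _ _ _ s) (lock _ _ _ s') =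
  cong (λ ρ → _ ∷ _ ∷ ρ) (swap-functional s s')
swap-functional (step t _ r s) (lock l _ _ _) = contradiction r (¬step-locked l t s)
swap-functional (lock l _ _ _) (step t _ r s) = contradiction r (¬step-locked l t s)

-- Effect of toggling on length, even parts and sum

swap-length : ∀ {π ρ} → Swap π ρ → length π ≡ length ρ
swap-length []             = refl
swap-length (step _ _ _ s) = cong suc (swap-length s)
swap-length (lock _ _ _ s) = cong (suc ∘ suc) (swap-length s)

toggle-ε : ∀ {a a'} → Toggle a a' → ε a + ε a' ≡ 1
toggle-ε (up {a} _)   = ε-suc a
toggle-ε (down {a} _) = trans (+-comm (ε (suc a)) (ε a)) (ε-suc a)

-- A part changes by exactly the change of its even indicator; the terms are arranged to avoid
-- subtraction.
toggle-sum : ∀ {a a'} → Toggle a a' → a' + ε a ≡ a + ε a'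
toggle-sum (up {a} o)   rewrite o | odd⇒ε-suc a o = lemma a
  where
  lemma : ∀ x → suc x + 0 ≡ x + 1
  lemma = solve-∀
toggle-sum (down {a} o) rewrite o | odd⇒ε-suc a o = lemma a
  where
  lemma : ∀ x → x + 1 ≡ suc x + 0
  lemma = solve-∀

interchange : ∀ a b c d → (a + b) + (c + d) ≡ (a + c) + (b + d)
interchange = solve-∀

-- A toggled part is even on exactly one side; a locked pair has one even part, counted on both
-- sides, which matches its length 2.
swap-evens : ∀ {π ρ} → Swap π ρ → evens π + evens ρ ≡ length π
swap-evens [] = refl
swap-evens (step {a} {a'} {π} {ρ} t _ _ s)
  rewrite evens-∷ a π | evens-∷ a' ρ =
  trans (interchange (ε a) (evens π) (ε a') (evens ρ)) (cong₂ _+_ (toggle-ε t) (swap-evens s))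
swap-evens (lock {c} {b} {π} {ρ} (locked oc ob _ _) _ _ s)
  rewrite evens-∷ (suc c) (b ∷ π) | evens-∷ (suc c) (b ∷ ρ) | evens-∷ b π | evens-∷ b ρ
        | odd⇒ε-suc c oc | ob =
  cong suc (trans (+-suc (evens π) (evens ρ)) (cong suc (swap-evens s)))

swap-sum : ∀ {π ρ} → Swap π ρ → sum ρ + evens π ≡ sum π + evens ρ
swap-sum [] = refl
swap-sum (step {a} {a'} {π} {ρ} t _ _ s)
  rewrite evens-∷ a π | evens-∷ a' ρ = begin
  (a' + sum ρ) + (ε a + evens π)   ≡⟨ interchange a' (sum ρ) (ε a) (evens π) ⟩
  (a' + ε a) + (sum ρ + evens π)   ≡⟨ cong₂ _+_ (toggle-sum t) (swap-sum s) ⟩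
  (a + ε a') + (sum π + evens ρ)   ≡⟨ interchange a (ε a') (sum π) (evens ρ) ⟩
  (a + sum π) + (ε a' + evens ρ)   ∎
  where open ≡-Reasoning
swap-sum (lock {c} {b} {π} {ρ} (locked oc ob _ _) _ _ s)
  rewrite evens-∷ (suc c) (b ∷ π) | evens-∷ (suc c) (b ∷ ρ) | evens-∷ b π | evens-∷ b ρ
        | odd⇒ε-suc c oc | ob = begin
  (suc c + (b + sum ρ)) + suc (evens π)   ≡⟨ regroup c b (sum ρ) (evens π) ⟩
  (2 + c + b) + (sum ρ + evens π)         ≡⟨ cong (_+_ (2 + c + b)) (swap-sum s) ⟩
  (2 + c + b) + (sum π + evens ρ)         ≡⟨ regroup c b (sum π) (evens ρ) ⟨
  (suc c + (b + sum π)) + suc (evens ρ)   ∎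
  where
  open ≡-Reasoning
  regroup : ∀ c b x y → (suc c + (b + x)) + suc y ≡ (2 + c + b) + (x + y)
  regroup = solve-∀

-- Subtracting 3

-- The index `t` is set at the bottom and only passed upward. The premise `1 ≤ x` leaves the part 3
-- to `trade`.
data Descent : ℕ → List ℕ → List ℕ → Set where
  empty : Descent 0 [] []
  drop₁ : Descent 2 (1 ∷ []) []
  drop₂ : Descent 1 (2 ∷ []) []
  trade : Descent 1 (3 ∷ []) (1 ∷ [])
  shift : ∀ {t x ρ μ} → 1 ≤ x → Descent t ρ μ → Descent t (3 + x ∷ ρ) (x ∷ μ)

descent-≤2 : ∀ {t ρ μ} → Descent t ρ μ → t ≤ 2
descent-≤2 empty       = z≤n
descent-≤2 drop₁       = s≤s (s≤s z≤n)
descent-≤2 drop₂       = s≤s z≤n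
descent-≤2 trade       = s≤s z≤n
descent-≤2 (shift _ d) = descent-≤2 d

descent-▷ : ∀ {t x b ρ μ} → SchurPair (3 + x) b → Descent t (b ∷ ρ) μ → x ▷ μ
descent-▷ _ drop₁       = tt
descent-▷ _ drop₂       = tt
descent-▷ {x = x} (p , q) trade = schurPair-¬3∣ʳ 4≤x ¬3∣1
  where
  4≤x : 4 ≤ x
  -- Here `x = 3` would put 6 directly above 3, the forbidden gap between multiples of 3.
  4≤x = ≤∧≢⇒< (+-cancelˡ-≤ 3 3 x p) λ { refl → q (refl , 3∣-+3 ∣-refl , ∣-refl) }
descent-▷ p (shift _ _) = schurPair-3+⁻¹ p

descent-▷⁻¹ : ∀ {t x y ρ μ} → SchurPair x y → Descent t ρ (y ∷ μ) → 3 + x ▷ ρ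
descent-▷⁻¹ (p , _) trade   = schurPair-far (s≤s (s≤s (s≤s p)))
descent-▷⁻¹ p (shift _ _)   = schurPair-3+ p

descent-total : ∀ {ρ} → Schur ρ → ∃[ t ] ∃[ μ ] Descent t ρ μ × Schur μ
descent-total nil = 0 , [] , empty , nil
descent-total (one {1} _) = 2 , [] , drop₁ , nil
descent-total (one {2} _) = 1 , [] , drop₂ , nil
descent-total (one {3} _) = 1 , 1 ∷ [] , trade , one (s≤s z≤n)
descent-total (one {suc (suc (suc (suc x)))} _) =
  0 , suc x ∷ [] , shift (s≤s z≤n) empty , one (s≤s z≤n)
-- A part above a positive part is at least 4, so it is `4 + x` and becomes `suc x`.
descent-total (cons {a} {b} {π} _ q s) with m≤n⇒∃[o]m+o≡n (≤-trans (+-monoˡ-≤ 3 (schur-head s)) (proj₁ q))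
... | x , refl =
  let t , μ , d , s' = descent-total s
  in t , suc x ∷ μ , shift (s≤s z≤n) d , schur-∷ (s≤s z≤n) (descent-▷ q d) s'

-- The bottom is rebuilt from `t`: nothing is appended for 0, a part 1 for 2, and a part 2 for 1
-- unless the last part is 1.
descent-total⁻¹ : ∀ {t μ} → t ≤ 2 → Schur μ → ∃[ ρ ] Descent t ρ μ × Schur ρ
descent-total⁻¹ {0} _ nil = _ , empty , nil
descent-total⁻¹ {1} _ nil = _ , drop₂ , one (s≤s z≤n)
descent-total⁻¹ {2} _ nil = _ , drop₁ , one (s≤s z≤n)
descent-total⁻¹ {0} _ (one p) = _ , shift p empty , one (s≤s z≤n)
-- Appending 2 would give 4 above 2, too small a gap, so this 1 comes from 3.
descent-total⁻¹ {1} _ (one {1} _) = _ , trade , one (s≤s z≤n)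
descent-total⁻¹ {1} _ (one {suc (suc x)} p) = _ , shift p drop₂ ,
  cons (s≤s z≤n) (schurPair-¬3∣ʳ (m≤m+n 5 x) (from-no (3 ∣? 2))) (one (s≤s z≤n))
descent-total⁻¹ {2} _ (one {suc x} p) = _ , shift p drop₁ ,
  cons (s≤s z≤n) (schurPair-¬3∣ʳ (m≤m+n 4 x) ¬3∣1) (one (s≤s z≤n))
descent-total⁻¹ {suc (suc (suc _))} (s≤s (s≤s ())) nil
descent-total⁻¹ {suc (suc (suc _))} (s≤s (s≤s ())) (one _)
descent-total⁻¹ t≤2 (cons p q s) =
  let _ , d , s' = descent-total⁻¹ t≤2 s
  in _ , shift p d , schur-∷ (s≤s z≤n) (descent-▷⁻¹ q d) s'

descent-functional : ∀ {t t' ρ μ μ'} → Descent t ρ μ → Descent t' ρ μ' → μ ≡ μ'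
descent-functional empty        empty         = refl
descent-functional drop₁        drop₁         = refl
descent-functional drop₂        drop₂         = refl
descent-functional trade        trade         = refl
descent-functional trade        (shift () _)
descent-functional (shift () _) trade
descent-functional (shift _ d)  (shift _ d')  = cong (_ ∷_) (descent-functional d d')

¬schur-4-2 : ¬ Schur (4 ∷ 2 ∷ [])
¬schur-4-2 (cons _ (p , _) _) = from-no (5 ≤? 4) p

-- With `t = 1`, the single part 3 and the parts 4, 2 both descend to the single part 1; the Schur
-- hypotheses exclude this collision.
descent-injective : ∀ {t ρ ρ' μ} → Schur ρ → Schur ρ' → Descent t ρ μ → Descent t ρ' μ → ρ ≡ ρ'
descent-injective s s' empty           empty           = refl
descent-injective s s' drop₁           drop₁           = refl
descent-injective s s' drop₂           drop₂           = refl
descent-injective s s' trade           trade           = refl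
descent-injective s s' trade           (shift _ drop₂) = contradiction s' ¬schur-4-2
descent-injective s s' (shift _ drop₂) trade           = contradiction s ¬schur-4-2
descent-injective s s' (shift _ d)     (shift _ d')    =
  cong (_ ∷_) (descent-injective (schur-tail s) (schur-tail s') d d')

-- Shifting by 3 flips parity, so a shifted part adds 1 through the length and 1 for being even
-- before or after. At the bottom `t` supplies what is missing.
descent-mval : ∀ {t ρ μ} → Descent t ρ μ → (mval μ + t) + evens ρ ≡ length ρ + length ρ
descent-mval empty = refl
descent-mval drop₁ = refl
descent-mval drop₂ = refl
descent-mval trade = refl
descent-mval (shift {t} {x} {ρ} {μ} _ d)
  rewrite evens-∷ (3 + x) ρ | evens-∷ x μ = begin
  (suc (length μ + (ε x + evens μ)) + t) + (ε (suc x) + evens ρ)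
    ≡⟨ regroup (length μ) (ε x) (evens μ) t (ε (suc x)) (evens ρ) ⟩
  suc ((ε x + ε (suc x)) + ((mval μ + t) + evens ρ))
    ≡⟨ cong₂ (λ u v → suc (u + v)) (ε-suc x) (descent-mval d) ⟩
  suc (suc (length ρ + length ρ))
    ≡⟨ cong suc (+-suc (length ρ) (length ρ)) ⟨
  suc (length ρ) + suc (length ρ) ∎
  where
  open ≡-Reasoning
  regroup : ∀ l e k t f r → (suc (l + (e + k)) + t) + (f + r) ≡ suc ((e + f) + (((l + k) + t) + r))
  regroup = solve-∀

-- `t` measures how far the bottom part falls short of losing 3: by 2 for a part 1, by 1 for a part
-- 2 or 3.
descent-sum : ∀ {t ρ μ} → Descent t ρ μ → sum μ + 3 * length ρ ≡ sum ρ + t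
descent-sum empty = refl
descent-sum drop₁ = refl
descent-sum drop₂ = refl
descent-sum trade = refl
descent-sum (shift {t} {x} {ρ} {μ} _ d) = begin
  (x + sum μ) + 3 * suc (length ρ)   ≡⟨ regroup x (sum μ) (length ρ) ⟩
  (3 + x) + (sum μ + 3 * length ρ)   ≡⟨ cong (_+_ (3 + x)) (descent-sum d) ⟩
  (3 + x) + (sum ρ + t)              ≡⟨ +-assoc (3 + x) (sum ρ) t ⟨
  ((3 + x) + sum ρ) + t              ∎
  where
  open ≡-Reasoning
  regroup : ∀ x s l → (x + s) + 3 * suc l ≡ (3 + x) + (s + 3 * l)
  regroup = solve-∀

-- The composite correspondence

Φ : ℕ → List ℕ → List ℕ → Set
Φ t π μ = ∃[ ρ ] Swap π ρ × Descent t ρ μ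

Φ-total : ∀ {π} → Schur π → ∃[ t ] ∃[ μ ] Φ t π μ × Schur μ
Φ-total s =
  let ρ , sw         = swap-total s
      t , μ , d , s' = descent-total (swap-schurˡ (swap-sym sw))
  in t , μ , (ρ , sw , d) , s'

Φ-total⁻¹ : ∀ {t μ} → t ≤ 2 → Schur μ → ∃[ π ] Φ t π μ × Schur π
Φ-total⁻¹ t≤2 s =
  let ρ , d , s' = descent-total⁻¹ t≤2 s
      π , sw     = swap-total s'
  in π , (ρ , swap-sym sw , d) , swap-schurˡ (swap-sym sw)

Φ-functional : ∀ {t t' π μ μ'} → Φ t π μ → Φ t' π μ' → μ ≡ μ'
Φ-functional (_ , sw , d) (_ , sw' , d') with swap-functional sw sw'
... | refl = descent-functional d d'

Φ-injective : ∀ {t π π' μ} → Φ t π μ → Φ t π' μ → π ≡ π'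
Φ-injective (_ , sw , d) (_ , sw' , d')
  with descent-injective (swap-schurˡ (swap-sym sw)) (swap-schurˡ (swap-sym sw')) d d'
... | refl = swap-functional (swap-sym sw) (swap-sym sw')

-- Adding `evens ρ`, with `ρ` the toggled list, turns both sides into twice the number of parts.
Φ-mval : ∀ {t π μ} → Φ t π μ → mval μ + t ≡ mval π
Φ-mval {t} {π} {μ} (ρ , sw , d) = +-cancelʳ-≡ (evens ρ) _ _ (begin
  (mval μ + t) + evens ρ            ≡⟨ descent-mval d ⟩
  length ρ + length ρ               ≡⟨ cong (λ l → l + l) (swap-length sw) ⟨
  length π + length π               ≡⟨ cong (_+_ (length π)) (swap-evens sw) ⟨
  length π + (evens π + evens ρ)    ≡⟨ +-assoc (length π) (evens π) (evens ρ) ⟨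
  mval π + evens ρ                  ∎)
  where open ≡-Reasoning

-- Toggling adds `evens ρ - evens π`, which is `length π - 2 * evens π`; the descent then removes
-- `3 * length π - t`. The net loss is `2 * mval π - t`.
Φ-sum : ∀ {t π μ} → Φ t π μ → sum μ + 2 * mval π ≡ sum π + t
Φ-sum {t} {π} {μ} (ρ , sw , d) = +-cancelʳ-≡ (evens ρ) _ _ (begin
  (sum μ + 2 * (length π + evens π)) + evens ρ
    ≡⟨ regroup (sum μ) (length π) (evens π) (evens ρ) ⟩
  (sum μ + 2 * length π) + (evens π + evens ρ) + evens π
    ≡⟨ cong (λ l → (sum μ + 2 * length π) + l + evens π) (swap-evens sw) ⟩
  (sum μ + 2 * length π) + length π + evens π
    ≡⟨ cong (_+ evens π) (collect (sum μ) (length π)) ⟩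
  (sum μ + 3 * length π) + evens π
    ≡⟨ cong (λ l → (sum μ + 3 * l) + evens π) (swap-length sw) ⟩
  (sum μ + 3 * length ρ) + evens π
    ≡⟨ cong (_+ evens π) (descent-sum d) ⟩
  (sum ρ + t) + evens π
    ≡⟨ exchange (sum ρ) t (evens π) ⟩
  (sum ρ + evens π) + t
    ≡⟨ cong (_+ t) (swap-sum sw) ⟩
  (sum π + evens ρ) + t
    ≡⟨ exchange (sum π) (evens ρ) t ⟩
  (sum π + t) + evens ρ ∎)
  where
  open ≡-Reasoning
  regroup : ∀ s l e f → (s + 2 * (l + e)) + f ≡ (s + 2 * l) + (e + f) + e
  regroup = solve-∀
  collect : ∀ s l → (s + 2 * l) + l ≡ s + 3 * l
  collect = solve-∀
  exchange : ∀ a b c → (a + b) + c ≡ (a + c) + b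
  exchange = solve-∀

-- Integer indices and their subtraction-free form

≡-ℤ⇒+≡+ : ∀ {x y n t} → + x ≡ + n ℤ.- + y ℤ.+ + t → x + y ≡ n + t
≡-ℤ⇒+≡+ {x} {y} {n} {t} e =
  ℤ.+-injective (trans (cong (ℤ._+ + y) e) (cancel (+ n) (+ y) (+ t)))
  where
  cancel : ∀ n y t → n ℤ.- y ℤ.+ t ℤ.+ y ≡ n ℤ.+ t
  cancel = ℤSolver.solve-∀

+≡+⇒≡-ℤ : ∀ {x y n t} → x + y ≡ n + t → + x ≡ + n ℤ.- + y ℤ.+ + t
+≡+⇒≡-ℤ {x} {y} {n} {t} e = begin
  + x                         ≡⟨ insert (+ x) (+ y) ⟩
  + x ℤ.+ + y ℤ.- + y         ≡⟨ cong (λ k → + k ℤ.- + y) e ⟩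
  + n ℤ.+ + t ℤ.- + y         ≡⟨ exchange (+ n) (+ y) (+ t) ⟩
  + n ℤ.- + y ℤ.+ + t         ∎
  where
  open ≡-Reasoning
  insert : ∀ x y → x ≡ x ℤ.+ y ℤ.- y
  insert = ℤSolver.solve-∀
  exchange : ∀ n y t → n ℤ.+ t ℤ.- y ≡ n ℤ.- y ℤ.+ t
  exchange = ℤSolver.solve-∀

In𝒟-t : ℕ → ℕ → ℕ → List ℕ → Set
In𝒟-t t m n μ = In𝒟 (+ m ℤ.- + t) (+ n ℤ.- + (2 * m) ℤ.+ + t) μ

InTargetAt : ℕ → ℕ → ℕ → List ℕ → Set
InTargetAt t m n μ = Schur μ × mval μ + t ≡ m × sum μ + 2 * m ≡ n + t

fromAt : ∀ {t m n μ} → InTargetAt t m n μ → In𝒟-t t m n μ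
fromAt {t} {m} {n} {μ} (s , p , q) =
  s , +≡+⇒≡-ℤ q
    -- Reading `m - t` as `m - t + 0` gives the shape of the conversion lemma.
    , trans (+≡+⇒≡-ℤ {mval μ} {t} {m} {0} (trans p (sym (+-identityʳ m)))) (ℤ.+-identityʳ _)

toAt : ∀ {t m n μ} → In𝒟-t t m n μ → InTargetAt t m n μ
toAt {t} {m} {n} {μ} (s , q , p) =
  s , trans (≡-ℤ⇒+≡+ {mval μ} {t} {m} {0} (trans p (sym (ℤ.+-identityʳ _)))) (+-identityʳ m)
    , ≡-ℤ⇒+≡+ q

intoTarget : ∀ {t m n μ} → t ≤ 2 → InTargetAt t m n μ → InTarget m n μ
intoTarget {0} {m} {n} {μ} _ i =
  let s , q , p = fromAt {0} {m} {n} i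
  in inj₁ (s , trans q (ℤ.+-identityʳ _) , trans p (ℤ.+-identityʳ _))
intoTarget {1} {m} {n} _ i = inj₂ (inj₁ (fromAt {1} {m} {n} i))
intoTarget {2} {m} {n} _ i = inj₂ (inj₂ (fromAt {2} {m} {n} i))
intoTarget {suc (suc (suc _))} (s≤s (s≤s ())) _

fromTarget : ∀ {m n μ} → InTarget m n μ → ∃[ t ] t ≤ 2 × InTargetAt t m n μ
fromTarget {m} {n} (inj₁ (s , q , p)) = 0 , z≤n ,
  toAt {0} {m} {n} (s , trans q (sym (ℤ.+-identityʳ _)) , trans p (sym (ℤ.+-identityʳ _)))
fromTarget {m} {n} (inj₂ (inj₁ i)) = 1 , s≤s z≤n , toAt {1} {m} {n} i
fromTarget {m} {n} (inj₂ (inj₂ i)) = 2 , s≤s (s≤s z≤n) , toAt {2} {m} {n} i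

Φ-InTarget : ∀ {t m n π μ} → In𝒟 (+ m) (+ n) π → Φ t π μ → Schur μ → InTarget m n μ
Φ-InTarget (_ , refl , refl) φ@(_ , _ , d) s =
  intoTarget (descent-≤2 d) (s , Φ-mval φ , Φ-sum φ)

Φ-In𝒟 : ∀ {t m n π μ} → InTargetAt t m n μ → Φ t π μ → Schur π → In𝒟 (+ m) (+ n) π
Φ-In𝒟 {t} {μ = μ} (_ , refl , q) φ s = s
  , cong +_ (+-cancelʳ-≡ t _ _ (trans (sym (Φ-sum φ))
      (trans (cong (λ k → sum μ + 2 * k) (sym (Φ-mval φ))) q)))
  , cong +_ (sym (Φ-mval φ))

-- The number t is determined by the values of mval.
Φ-injective-mval : ∀ {t t' π π' μ} → mval π ≡ mval π' → Φ t π μ → Φ t' π' μ → π ≡ π'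
Φ-injective-mval {t} {t'} {μ = μ} e φ φ'
  with +-cancelˡ-≡ (mval μ) t t' (trans (Φ-mval φ) (trans e (sym (Φ-mval φ'))))
... | refl = Φ-injective φ φ'

theorem4 : (m n : ℕ) → Bijection (𝒟 (+ m) (+ n)) (Target m n)
theorem4 m n = record
  { to        = λ { (π , i) → let _ , μ , φ , s = Φ-total (proj₁ i) in μ , Φ-InTarget i φ s }
  -- Setoid equality compares lists only, so the Schur proofs `s` and `s'` may differ; the image
  -- does not depend on them.
  ; cong      = λ { {π , s , _} {_ , s' , _} refl → Φ-functional (image s) (image s') }
  ; bijective =
      (λ { {π , s , _ , p} {π' , s' , _ , p'} e →
           Φ-injective-mval (ℤ.+-injective (trans p (sym p')))
             (subst (Φ _ π) e (image s)) (image s') })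
    , (λ { (μ , j) →
           let t , t≤2 , i  = fromTarget {m} {n} j
               π , φ , s    = Φ-total⁻¹ t≤2 (proj₁ i)
           -- The forward map computes its own `t`; functionality across different indices still
           -- yields `μ`.
           in (π , Φ-In𝒟 i φ s) , λ { {_ , s' , _} refl → Φ-functional (image s') φ } })
  }
  where
  image : ∀ {π} (s : Schur π) → Φ (proj₁ (Φ-total s)) π (proj₁ (proj₂ (Φ-total s)))
  image s = proj₁ (proj₂ (proj₂ (Φ-total s)))
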